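{- Let $G$ be a $k$-regular bipartite graph of order $m$ with $k\geq 2$, and let $H$ be a $2t$-regular graph of order $n$ that admits a neighborhood balanced coloring and that admits a local distance antimagic labeling. Then $\chi_{ld}(G[H])\leq 2\,\chi_{ld}(H)$.
   Context: All graphs are finite, simple, undirected and without isolated vertices. For a graph $G$ of order $n$ and a bijection $f\colon V(G)\to\{1,2,\dots,n\}$, the weight of a vertex $u$ is $w_f(u)=\sum_{x\in N(u)}f(x)$, where $N(u)$ is the open neighborhood of $u$. The bijection $f$ is a local distance antimagic labeling of $G$ if $w_f(u)\neq w_f(v)$ for every edge $uv$ of $G$. The local distance antimagic chromatic number $\chi_{ld}(G)$ is the minimum number of distinct weights over all local distance antimagic labelings of $G$ (an upper bound on $\chi_{ld}$ includes the assertion that such a labeling exists). A neighborhood balanced coloring of a graph is an assignment of one of two colors to each vertex (not necessarily proper) such that every vertex has equally many neighbors of each color. The lexicographic product (composition) $G[H]$ has vertex set $V(G)\times V(H)$, with $(g,h)$ and $(g',h')$ adjacent iff either $gg'\in E(G)$, or $g=g'$ and $hh'\in E(H)$. -}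

module Defs where

open import Data.Bool using (Bool; true; false)
import Data.Bool.Properties as Bool
open import Data.Fin using (Fin; toℕ; combine; remQuot)
open import Data.Fin.Properties using (remQuot-combine)
import Data.Fin.Properties as Fin
open import Data.List using (List; length; map; filter; sum; deduplicate; allFin)
open import Data.Nat using (ℕ; suc; _*_; _≤_)
import Data.Nat.Properties as ℕ
open import Data.Product using (_×_; _,_; proj₁; ∃-syntax; Σ-syntax)
open import Data.Sum using (_⊎_; inj₁; inj₂)
open import Function.Bundles using (_⤖_; Bijection)
open import Level using (0ℓ)
open import Relation.Binary.Core using (Rel)
open import Relation.Binary.Definitions using (Decidable; Symmetric; Irreflexive)
open import Relation.Binary.PropositionalEquality
  using (_≡_; _≢_; refl; sym; cong; subst)
open import Relation.Nullary.Decidable using (_×-dec_; _⊎-dec_)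

record Graph (n : ℕ) : Set₁ where
  field
    Adj        : Rel (Fin n) 0ℓ
    adj?       : Decidable Adj
    symmetric  : Symmetric Adj
    loopless   : Irreflexive _≡_ Adj
    noIsolated : ∀ u → ∃[ v ] Adj u v

  N : Fin n → List (Fin n)
  N u = filter (adj? u) (allFin n)

open Graph

Regular : ∀ {n} → ℕ → Graph n → Set
Regular k G = ∀ u → length (N G u) ≡ k

Bipartite : ∀ {n} → Graph n → Set
Bipartite {n} G =
  Σ[ side ∈ (Fin n → Bool) ] (∀ u v → Adj G u v → side u ≢ side v)

NeighborhoodBalanced : ∀ {n} → Graph n → (Fin n → Bool) → Set
NeighborhoodBalanced G c = ∀ u →
    length (filter (λ v → c v Bool.≟ true)  (N G u))
  ≡ length (filter (λ v → c v Bool.≟ false) (N G u))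

AdmitsNeighborhoodBalancedColoring : ∀ {n} → Graph n → Set
AdmitsNeighborhoodBalancedColoring G = ∃[ c ] NeighborhoodBalanced G c

-- The element i of Fin n stands for the label i + 1 of {1, …, n}.
Labeling : ℕ → Set
Labeling n = Fin n ⤖ Fin n

label : ∀ {n} → Labeling n → Fin n → ℕ
label f x = suc (toℕ (Bijection.to f x))

weight : ∀ {n} → Graph n → Labeling n → Fin n → ℕ
weight G f u = sum (map (label f) (N G u))

IsLocalDistanceAntimagic : ∀ {n} → Graph n → Labeling n → Set
IsLocalDistanceAntimagic G f = ∀ u v → Adj G u v → weight G f u ≢ weight G f v

AdmitsLocalDistanceAntimagic : ∀ {n} → Graph n → Set
AdmitsLocalDistanceAntimagic G = ∃[ f ] IsLocalDistanceAntimagic G f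

#weights : ∀ {n} → Graph n → Labeling n → ℕ
#weights {n} G f = length (deduplicate ℕ._≟_ (map (weight G f) (allFin n)))

-- χld G ≔ c says that the minimum defining the local distance antimagic
-- chromatic number of G exists and equals c.  It is a relation because the
-- minimum is undefined for a graph with no local distance antimagic labeling.
χld_≔_ : ∀ {n} → Graph n → ℕ → Set
χld G ≔ c =
    (∃[ f ] (IsLocalDistanceAntimagic G f × #weights G f ≡ c))
  × (∀ f → IsLocalDistanceAntimagic G f → c ≤ #weights G f)

-- The vertex (g , h) is encoded in Fin (m * n) as combine g h.
infix 10 _[_]
_[_] : ∀ {m n} → Graph m → Graph n → Graph (m * n)
_[_] {m} {n} G H = record
  { Adj        = λ x y → _~_ (remQuot n x) (remQuot n y)
  ; adj?       = λ x y →
      let (g , h) = remQuot n x ; (g′ , h′) = remQuot n y in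
      adj? G g g′ ⊎-dec (g Fin.≟ g′ ×-dec adj? H h h′)
  ; symmetric  = λ { (inj₁ e)        → inj₁ (symmetric G e)
                   ; (inj₂ (eq , e)) → inj₂ (sym eq , symmetric H e) }
  ; loopless   = λ { refl (inj₁ e)       → loopless G refl e
                   ; refl (inj₂ (_ , e)) → loopless H refl e }
  ; noIsolated = λ x →
      let (g , h) = remQuot n x ; (g′ , e) = noIsolated G g in
      combine g′ h ,
      inj₁ (subst (Adj G g) (sym (cong proj₁ (remQuot-combine g′ h))) e)
  }
  where
  _~_ : Rel (Fin m × Fin n) 0ℓ
  (g , h) ~ (g′ , h′) = Adj G g g′ ⊎ (g ≡ g′ × Adj H h h′)

{-# OPTIONS --safe #-}
module Submission where

-- Double counting edges shows that the sides of G have the same size p and that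
-- the two colours of H are equally frequent, each vertex of H having t
-- neighbours of either colour.  Let f be an optimal labeling of H and let g be
-- the vertex of index i < p (counted from 0) on its side of G.  Label (g , h) by
--   offset + p (f(h) − 1) + (i + 1 or p − i, according to the colour of h),
-- with offset 0 on one side and n p on the other.  In every sum over a
-- neighbourhood of H, or over all of H, the last terms balance, so i cancels:
-- the weight of (g , h) is p w_f(h) plus a constant depending only on the side
-- of g.  The two constants differ by p (k n² − 2 t n), more than p times the
-- difference of any two weights of f, so each side shows exactly the weights of
-- f rescaled, and the two sides share no weight.
--
-- The minimum defining χld exists constructively because a labeling better than
-- a given one can be searched for among the finitely many maps Fin n → Fin n.

open import Data.Bool using (Bool; true; false; not; _∧_; _∨_)
import Data.Bool.Properties as Bool
open import Data.Fin using (Fin; zero; suc; toℕ; cast; combine; remQuot; fromℕ<; opposite; punchOut; finToFun; funToFin; _↑ˡ_; _↑ʳ_)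
import Data.Fin.Properties as Fin
open import Data.List using (List; []; _∷_; _++_; length; map; filter; tabulate; allFin; deduplicate; lookup)
import Data.List.Properties as List
open import Data.List.Membership.Propositional using (_∈_)
open import Data.List.Membership.Propositional.Properties using (∈-filter⁺; ∈-allFin; ∈-map⁺; ∈-map⁻; ∈-++⁺ˡ; ∈-++⁺ʳ; ∈-deduplicate⁺; ∈-deduplicate⁻; ∈-lookup)
open import Data.List.Relation.Binary.Subset.Propositional using (_⊆_)
open import Data.List.Relation.Unary.Any using (index; here; there)
open import Data.List.Relation.Unary.Any.Properties using (lookup-index)
open import Data.List.Relation.Unary.Unique.Propositional using (Unique)
open import Data.List.Relation.Unary.AllPairs using (_∷_)
import Data.List.Relation.Unary.All as All
open import Data.List.Relation.Unary.Unique.DecPropositional.Properties using (deduplicate-!)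
open import Data.Nat using (ℕ; zero; suc; _+_; _*_; _∸_; _≤_; _<_; _^_; z≤n; s≤s; NonZero; >-nonZero)
import Data.Nat.Properties as ℕ
import Data.Nat.ListAction as List
open import Data.Nat.Induction using (<-rec)
open import Data.Nat.Tactic.RingSolver using (solve-∀)
open import Data.Product using (_×_; _,_; proj₁; proj₂; ∃-syntax; uncurry)
open import Data.Sum using (inj₁; inj₂)
open import Function using (_∘_; case_of_; Injective; Surjective)
open import Function.Bundles using (module Bijection; mk⤖)
open import Function.Consequences.Propositional using (strictlySurjective⇒surjective)
open import Relation.Binary.PropositionalEquality hiding ([_])
open import Relation.Nullary using (Dec; yes; no; does; contradiction; _×-dec_; _→-dec_; ¬?)
open import Relation.Nullary.Decidable using (map′; dec-true; dec-false)
open import Relation.Unary using (Decidable)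
open import Defs
open import Algebra.Properties.Semiring.Sum ℕ.+-*-semiring
  using (sum; sum-syntax; sum-cong-≗; ∑-distrib-+; ∑-comm; *-distribˡ-sum; *-distribʳ-sum)

open Graph

-- Search through labelings and existence of the minimum.

injective⇒surjective : ∀ {n} {f : Fin n → Fin n} → Injective _≡_ _≡_ f → Surjective _≡_ _≡_ f
injective⇒surjective {suc n} {f} inj = strictlySurjective⇒surjective λ y →
  case Fin.any? (λ x → f x Fin.≟ y) of λ
    { (yes hit) → hit
    -- Punching out a missed value `y` would turn `f` into an injection from `Fin (suc n)` to
    -- `Fin n`.
    ; (no miss) →
        let avoid : ∀ x → y ≢ f x
            avoid x y≡fx = miss (x , sym y≡fx)
        in contradiction
             (Fin.injective⇒≤ {f = λ x → punchOut (avoid x)}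
               (λ {x} {x′} eq → inj (Fin.punchOut-injective (avoid x) (avoid x′) eq)))
             ℕ.1+n≰n
    }

injective⇒labeling : ∀ {n} (f : Fin n → Fin n) → Injective _≡_ _≡_ f → Labeling n
injective⇒labeling f inj = mk⤖ {to = f} (inj , injective⇒surjective inj)

injective? : ∀ {n} (f : Fin n → Fin n) → Dec (Injective _≡_ _≡_ f)
injective? f = map′ (λ i {x} {y} → i x y) (λ i x y → i {x} {y})
  (Fin.all? λ x → Fin.all? λ y → (f x Fin.≟ f y) →-dec (x Fin.≟ y))

-- Maps `Fin n → Fin n` are coded by the elements of `Fin (n ^ n)`. Decoding returns a map only up
-- to pointwise equality, so `P` has to respect that equality.
anyLabeling? : ∀ {n} {P : Labeling n → Set} →
  (∀ f g → Bijection.to f ≗ Bijection.to g → P f → P g) →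
  (∀ f → Dec (P f)) → Dec (∃[ f ] P f)
anyLabeling? {n} {P} resp P? = map′ (λ (_ , f , _ , Pf) → f , Pf)
  (λ (f , Pf) → funToFin (Bijection.to f) , f ,
    (λ x → sym (Fin.finToFun-funToFin (Bijection.to f) x)) , Pf)
  (Fin.any? code?)
  where
  code? : (i : Fin (n ^ n)) → Dec (∃[ f ] (Bijection.to f ≗ finToFun i × P f))
  code? i with injective? (finToFun i)
  ... | no ¬inj = no λ (f , f≗ , _) →
    ¬inj λ {x} {y} eq → Bijection.injective f (trans (f≗ x) (trans eq (sym (f≗ y))))
  ... | yes inj = map′ (λ Pg → g , (λ _ → refl) , Pg) (λ (f , f≗ , Pf) → resp f g f≗ Pf) (P? g)
    where g = injective⇒labeling (finToFun i) inj

module _ {n} (G : Graph n) where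

  weight-cong : ∀ (f g : Labeling n) → Bijection.to f ≗ Bijection.to g → weight G f ≗ weight G g
  weight-cong f g eq u = cong List.sum (List.map-cong (λ x → cong (suc ∘ toℕ) (eq x)) (N G u))

  isLocalDistanceAntimagic? : ∀ f → Dec (IsLocalDistanceAntimagic G f)
  isLocalDistanceAntimagic? f = Fin.all? λ u → Fin.all? λ v →
    adj? G u v →-dec ¬? (weight G f u ℕ.≟ weight G f v)

  -- Well-founded descent on the number of weights: either the search finds a labeling with fewer
  -- weights, or the current one attains the minimum.
  χld-exists : AdmitsLocalDistanceAntimagic G → ∃[ c ] χld G ≔ c
  χld-exists (f , f-lda) = <-rec Goal step (#weights G f) f f-lda refl
    where
    Goal : ℕ → Set
    Goal c = ∀ f → IsLocalDistanceAntimagic G f → #weights G f ≡ c → ∃[ d ] χld G ≔ d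

    Better : ℕ → Labeling n → Set
    Better c g = IsLocalDistanceAntimagic G g × #weights G g < c

    better-resp : ∀ c f g → Bijection.to f ≗ Bijection.to g → Better c f → Better c g
    better-resp c f g eq (lda , lt) =
        (λ u v e → subst₂ _≢_ (weight-cong f g eq u) (weight-cong f g eq v) (lda u v e))
      , subst (_< c) (cong (length ∘ deduplicate ℕ._≟_) (List.map-cong (weight-cong f g eq) (allFin n))) lt

    step : ∀ c → (∀ {d} → d < c → Goal d) → Goal c
    step c rec f lda #f with anyLabeling? (better-resp c)
      (λ g → isLocalDistanceAntimagic? g ×-dec (#weights G g ℕ.<? c))
    ... | yes (g , lda′ , lt) = rec lt g lda′ refl
    ... | no none = c , (f , lda , #f) , λ g lda′ → ℕ.≮⇒≥ λ lt → none (g , lda′ , lt)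

-- Each position in `xs` is sent to a position of the same value in `ys`; without repetitions in
-- `xs` this map is injective.
unique-⊆⇒length≤ : ∀ {a} {A : Set a} {xs ys : List A} → Unique xs → xs ⊆ ys → length xs ≤ length ys
unique-⊆⇒length≤ {A = A} {xs} {ys} uniq sub = Fin.injective⇒≤ {f = pos} λ {i} {j} eq →
  lookup-injective uniq i j (trans (lookup-index (mem i)) (trans (cong (lookup ys) eq) (sym (lookup-index (mem j)))))
  where
  mem : ∀ i → lookup xs i ∈ ys
  mem i = sub (∈-lookup i)

  pos : Fin (length xs) → Fin (length ys)
  pos i = index (mem i)

  lookup-injective : ∀ {xs : List A} → Unique xs → ∀ i j → lookup xs i ≡ lookup xs j → i ≡ j
  lookup-injective (_ ∷ _)  zero    zero    _  = refl
  lookup-injective (x∉ ∷ _) zero    (suc j) eq = contradiction eq (All.lookup x∉ (∈-lookup j))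
  lookup-injective (x∉ ∷ _) (suc i) zero    eq = contradiction (sym eq) (All.lookup x∉ (∈-lookup i))
  lookup-injective (_ ∷ u)  (suc i) (suc j) eq = cong suc (lookup-injective u i j eq)

-- Indicators and finite sums.

⟦_⟧ : Bool → ℕ
⟦ true ⟧  = 1
⟦ false ⟧ = 0

-- Phrased through `does` so that it coincides with the factor that `sum-map-filter` produces from
-- the filters in `NeighborhoodBalanced`.
χ : Bool → Bool → ℕ
χ b x = ⟦ does (x Bool.≟ b) ⟧

χ-refl : ∀ b → χ b b ≡ 1
χ-refl true  = refl
χ-refl false = refl

χ-partition : ∀ x → χ true x + χ false x ≡ 1
χ-partition true  = refl
χ-partition false = refl

χ-select : ∀ (r : Bool → ℕ) x → r x ≡ χ true x * r true + χ false x * r false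
χ-select r true  = sym (trans (ℕ.+-identityʳ _) (ℕ.*-identityˡ _))
χ-select r false = sym (ℕ.*-identityˡ _)

χ-opposite : ∀ {x y} → x ≢ y → χ true x ≡ χ false y
χ-opposite {true}  {true}  x≢y = contradiction refl x≢y
χ-opposite {true}  {false} x≢y = refl
χ-opposite {false} {true}  x≢y = refl
χ-opposite {false} {false} x≢y = contradiction refl x≢y

count : ∀ {n} → Bool → (Fin n → Bool) → ℕ
count {n} b s = ∑[ i < n ] χ b (s i)

∑-distrib-+³ : ∀ {n} (f g h : Fin n → ℕ) → ∑[ i < n ] (f i + g i + h i) ≡ sum f + sum g + sum h
∑-distrib-+³ f g h = trans (∑-distrib-+ (λ i → f i + g i) h) (cong (_+ sum h) (∑-distrib-+ f g))

∑-const : ∀ n x → ∑[ i < n ] x ≡ n * x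
∑-const zero    x = refl
∑-const (suc n) x = cong (x +_) (∑-const n x)

∑-zero : ∀ n → ∑[ i < n ] 0 ≡ 0
∑-zero n = trans (∑-const n 0) (ℕ.*-zeroʳ n)

∑-mono-≤ : ∀ {n} {f g : Fin n → ℕ} → (∀ i → f i ≤ g i) → sum f ≤ sum g
∑-mono-≤ {zero}  f≤g = z≤n
∑-mono-≤ {suc n} f≤g = ℕ.+-mono-≤ (f≤g zero) (∑-mono-≤ (f≤g ∘ suc))

∑-select : ∀ {n} (g : Fin n) (f : Fin n → ℕ) → ∑[ i < n ] (⟦ does (g Fin.≟ i) ⟧ * f i) ≡ f g
∑-select {suc n} zero    f = trans (cong (1 * f zero +_) (∑-zero n)) (trans (ℕ.+-identityʳ _) (ℕ.*-identityˡ _))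
∑-select {suc n} (suc g) f = ∑-select g (f ∘ suc)

∑-↑ : ∀ a {b} (f : Fin (a + b) → ℕ) → sum f ≡ ∑[ i < a ] f (i ↑ˡ b) + ∑[ j < b ] f (a ↑ʳ j)
∑-↑ zero    f = refl
∑-↑ (suc a) f = trans (cong (f zero +_) (∑-↑ a (f ∘ suc))) (sym (ℕ.+-assoc (f zero) _ _))

∑-combine : ∀ m {n} (f : Fin (m * n) → ℕ) → sum f ≡ ∑[ i < m ] ∑[ j < n ] f (combine i j)
∑-combine zero        f = refl
∑-combine (suc m) {n} f = trans (∑-↑ n f) (cong (∑[ j < n ] f (j ↑ˡ m * n) +_) (∑-combine m (f ∘ (n ↑ʳ_))))

∑-colours : ∀ {n} (wt : Fin n → ℕ) (c : Fin n → Bool) (r : Bool → ℕ) →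
  ∑[ v < n ] (wt v * r (c v)) ≡
  (∑[ v < n ] (wt v * χ true (c v))) * r true + (∑[ v < n ] (wt v * χ false (c v))) * r false
∑-colours {n} wt c r = begin
  ∑[ v < n ] (wt v * r (c v))
    ≡⟨ sum-cong-≗ (λ v → trans (cong (wt v *_) (χ-select r (c v)))
         (distrib (wt v) (χ true (c v)) (r true) (χ false (c v)) (r false))) ⟩
  ∑[ v < n ] (wt v * χ true (c v) * r true + wt v * χ false (c v) * r false)
    ≡⟨ ∑-distrib-+ (λ v → wt v * χ true (c v) * r true) (λ v → wt v * χ false (c v) * r false) ⟩
  ∑[ v < n ] (wt v * χ true (c v) * r true) + ∑[ v < n ] (wt v * χ false (c v) * r false)
    ≡⟨ cong₂ _+_ (*-distribʳ-sum (r true) (λ v → wt v * χ true (c v))) (*-distribʳ-sum (r false) (λ v → wt v * χ false (c v))) ⟨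
  (∑[ v < n ] (wt v * χ true (c v))) * r true + (∑[ v < n ] (wt v * χ false (c v))) * r false ∎
  where
  open ≡-Reasoning
  distrib : ∀ w a x b y → w * (a * x + b * y) ≡ w * a * x + w * b * y
  distrib = solve-∀

-- Trades a filter for an indicator factor, so that neighbourhood lists become sums over all of
-- `Fin n`.
sum-map-filter : ∀ {A : Set} {P : A → Set} (P? : Decidable P) (f : A → ℕ) xs →
  List.sum (map f (filter P? xs)) ≡ List.sum (map (λ x → ⟦ does (P? x) ⟧ * f x) xs)
sum-map-filter P? f [] = refl
sum-map-filter P? f (x ∷ xs) with does (P? x)
... | true  = cong₂ _+_ (sym (ℕ.*-identityˡ (f x))) (sum-map-filter P? f xs)
... | false = sum-map-filter P? f xs

sum-map-tabulate : ∀ {A : Set} {n} (f : A → ℕ) (g : Fin n → A) → List.sum (map f (tabulate g)) ≡ sum (f ∘ g)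
sum-map-tabulate {n = zero}  f g = refl
sum-map-tabulate {n = suc n} f g = cong (f (g zero) +_) (sum-map-tabulate f (g ∘ suc))

length≡sum : ∀ {A : Set} (xs : List A) → length xs ≡ List.sum (map (λ _ → 1) xs)
length≡sum []       = refl
length≡sum (x ∷ xs) = cong suc (length≡sum xs)

-- Degrees and double counting in regular graphs.

module _ {n} (G : Graph n) where

  adjacency : Fin n → Fin n → ℕ
  adjacency u v = ⟦ does (adj? G u v) ⟧

  adjacency-adj : ∀ {u v} → Adj G u v → adjacency u v ≡ 1
  adjacency-adj {u} {v} e = cong ⟦_⟧ (dec-true (adj? G u v) e)

  -- Off the edges both products vanish, so `x ≡ y` is only required along an edge.
  adjacency-cong : ∀ {u v x y} → (Adj G u v → x ≡ y) → adjacency u v * x ≡ adjacency u v * y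
  adjacency-cong {u} {v} eq with adj? G u v
  ... | yes e = cong (1 *_) (eq e)
  ... | no  _ = refl

  adjacency-sym : ∀ u v → adjacency u v ≡ adjacency v u
  adjacency-sym u v with adj? G u v
  ... | yes e = sym (adjacency-adj (symmetric G e))
  ... | no ¬e = cong ⟦_⟧ (sym (dec-false (adj? G v u) (¬e ∘ symmetric G)))

  sum-N : ∀ (f : Fin n → ℕ) u → List.sum (map f (N G u)) ≡ ∑[ v < n ] (adjacency u v * f v)
  sum-N f u = trans (sum-map-filter (adj? G u) f (allFin n)) (sum-map-tabulate (λ v → adjacency u v * f v) (λ v → v))

  length-N : ∀ u → length (N G u) ≡ ∑[ v < n ] adjacency u v
  length-N u = trans (length≡sum (N G u))
    (trans (sum-N (λ _ → 1) u) (sum-cong-≗ (λ v → ℕ.*-identityʳ (adjacency u v))))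

  length-filter-N : ∀ (c : Fin n → Bool) b u →
    length (filter (λ v → c v Bool.≟ b) (N G u)) ≡ ∑[ v < n ] (adjacency u v * χ b (c v))
  length-filter-N c b u = begin
    length (filter (λ v → c v Bool.≟ b) (N G u))
      ≡⟨ length≡sum (filter (λ v → c v Bool.≟ b) (N G u)) ⟩
    List.sum (map (λ _ → 1) (filter (λ v → c v Bool.≟ b) (N G u)))
      ≡⟨ sum-map-filter (λ v → c v Bool.≟ b) (λ _ → 1) (N G u) ⟩
    List.sum (map (λ v → χ b (c v) * 1) (N G u))
      ≡⟨ sum-N (λ v → χ b (c v) * 1) u ⟩
    ∑[ v < n ] (adjacency u v * (χ b (c v) * 1))
      ≡⟨ sum-cong-≗ (λ v → cong (adjacency u v *_) (ℕ.*-identityʳ (χ b (c v)))) ⟩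
    ∑[ v < n ] (adjacency u v * χ b (c v)) ∎
    where open ≡-Reasoning

  module _ {k} (regular : Regular k G) where

    degree : ∀ u → ∑[ v < n ] adjacency u v ≡ k
    degree u = trans (sym (length-N u)) (regular u)

    degree>0 : Fin n → 0 < k
    degree>0 u with v , e ← noIsolated G u = subst (0 <_) (regular u) (nonempty (∈-filter⁺ (adj? G u) (∈-allFin v) e))
      where
      nonempty : ∀ {x} {xs : List (Fin n)} → x ∈ xs → 0 < length xs
      nonempty (here _)  = s≤s z≤n
      nonempty (there _) = s≤s z≤n

    degree≤order : Fin n → k ≤ n
    degree≤order u = subst₂ _≤_ (regular u) (List.length-tabulate {n = n} (λ i → i)) (List.length-filter (adj? G u) (allFin n))

    -- After exchanging the sums, each `f v` is counted once for each of the `k` neighbours of `v`.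
    double-count : ∀ (f : Fin n → ℕ) → ∑[ u < n ] ∑[ v < n ] (adjacency u v * f v) ≡ k * sum f
    double-count f = begin
      ∑[ u < n ] ∑[ v < n ] (adjacency u v * f v)
        ≡⟨ ∑-comm (λ u v → adjacency u v * f v) ⟩
      ∑[ v < n ] ∑[ u < n ] (adjacency u v * f v)
        ≡⟨ sum-cong-≗ (λ v → trans (sum-cong-≗ (λ u → cong (_* f v) (adjacency-sym u v)))
             (trans (sym (*-distribʳ-sum (f v) (adjacency v))) (cong (_* f v) (degree v)))) ⟩
      ∑[ v < n ] (k * f v)
        ≡⟨ *-distribˡ-sum k f ⟨
      k * sum f ∎
      where open ≡-Reasoning

    cancel-degree : ∀ {f g : Fin n → ℕ} → k * sum f ≡ k * sum g → sum f ≡ sum g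
    cancel-degree eq = cancel (λ u → >-nonZero (degree>0 u)) eq
      where
      -- Positivity of `k` needs a vertex; for order 0 both sums are empty instead. The order is
      -- generalised to allow this case split.
      cancel : ∀ {n} {f g : Fin n → ℕ} → (Fin n → NonZero k) → k * sum f ≡ k * sum g → sum f ≡ sum g
      cancel {zero}  _  _  = refl
      cancel {suc n} k≢0 eq = ℕ.*-cancelˡ-≡ _ _ k {{k≢0 zero}} eq

    -- Every edge has one end on each side, so counting the edges from either side gives `k` times
    -- the size of that side.
    bipartite-halves : ∀ (s : Fin n → Bool) → (∀ u v → Adj G u v → s u ≢ s v) → count true s ≡ count false s
    bipartite-halves s proper = cancel-degree {χ true ∘ s} {χ false ∘ s} (begin
      k * count true s
        ≡⟨ *-distribˡ-sum k (χ true ∘ s) ⟩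
      ∑[ u < n ] (k * χ true (s u))
        ≡⟨ sum-cong-≗ (λ u → trans (cong (_* χ true (s u)) (sym (degree u))) (*-distribʳ-sum (χ true (s u)) (adjacency u))) ⟩
      ∑[ u < n ] ∑[ v < n ] (adjacency u v * χ true (s u))
        ≡⟨ sum-cong-≗ (λ u → sum-cong-≗ (λ v → adjacency-cong (χ-opposite ∘ proper u v))) ⟩
      ∑[ u < n ] ∑[ v < n ] (adjacency u v * χ false (s v))
        ≡⟨ double-count (χ false ∘ s) ⟩
      k * count false s ∎)
      where open ≡-Reasoning

    module _ (c : Fin n → Bool) (balanced : NeighborhoodBalanced G c) where

      balanced-nbrs : ∀ u →
        ∑[ v < n ] (adjacency u v * χ true (c v)) ≡ ∑[ v < n ] (adjacency u v * χ false (c v))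
      balanced-nbrs u = trans (sym (length-filter-N c true u)) (trans (balanced u) (length-filter-N c false u))

      -- Summing the balance condition over all vertices counts each vertex of either colour `k`
      -- times.
      balanced-halves : count true c ≡ count false c
      balanced-halves = cancel-degree {χ true ∘ c} {χ false ∘ c}
        (trans (sym (double-count (χ true ∘ c))) (trans (sum-cong-≗ balanced-nbrs) (double-count (χ false ∘ c))))

  -- The two colour counts around `u` are equal and add up to `2 * t`.
  balanced-half-degree : ∀ {t} → Regular (2 * t) G → ∀ c → NeighborhoodBalanced G c →
    ∀ b u → ∑[ v < n ] (adjacency u v * χ b (c v)) ≡ t
  balanced-half-degree {t} regular c balanced = λ where
      true  u → half u
      false u → trans (sym (balanced-nbrs regular c balanced u)) (half u)
    where
    open ≡-Reasoning
    half : ∀ u → ∑[ v < n ] (adjacency u v * χ true (c v)) ≡ t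
    half u = ℕ.*-cancelˡ-≡ _ _ 2 (begin
      2 * q true
        ≡⟨ cong (λ z → q true + (z + 0)) (balanced-nbrs regular c balanced u) ⟩
      q true + (q false + 0)
        ≡⟨ cong (q true +_) (ℕ.+-identityʳ (q false)) ⟩
      q true + q false
        ≡⟨ cong₂ _+_ (ℕ.*-identityʳ (q true)) (ℕ.*-identityʳ (q false)) ⟨
      q true * 1 + q false * 1
        ≡⟨ ∑-colours (adjacency u) c (λ _ → 1) ⟨
      ∑[ v < n ] (adjacency u v * 1)
        ≡⟨ sum-cong-≗ (λ v → ℕ.*-identityʳ (adjacency u v)) ⟩
      ∑[ v < n ] adjacency u v
        ≡⟨ degree regular u ⟩
      2 * t ∎)
      where
      q : Bool → ℕ
      q b = ∑[ v < n ] (adjacency u v * χ b (c v))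

-- Numbering the vertices within a side.

-- The number of indices before `i` that lie on the same side as `i`.
rank : ∀ {m} → (Fin m → Bool) → Fin m → ℕ
rank s zero    = 0
rank s (suc i) = χ (s (suc i)) (s zero) + rank (s ∘ suc) i

rank<count : ∀ {m} (s : Fin m → Bool) i → rank s i < count (s i) s
rank<count s zero rewrite χ-refl (s zero) = s≤s z≤n
rank<count s (suc i) = subst (_≤ count (s (suc i)) s) (ℕ.+-suc (χ (s (suc i)) (s zero)) _)
  (ℕ.+-monoʳ-≤ (χ (s (suc i)) (s zero)) (rank<count (s ∘ suc) i))

-- Of two different indices on one side, the later counts the earlier one and so has the larger
-- rank.
rank-injective : ∀ {m} (s : Fin m → Bool) i j → s i ≡ s j → rank s i ≡ rank s j → i ≡ j
rank-injective s zero    zero    _  _  = refl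
rank-injective s zero    (suc j) ss eq rewrite ss | χ-refl (s (suc j)) = contradiction eq λ ()
rank-injective s (suc i) zero    ss eq rewrite ss | χ-refl (s zero)    = contradiction eq λ ()
rank-injective s (suc i) (suc j) ss eq = cong suc (rank-injective (s ∘ suc) i j ss
  (ℕ.+-cancelˡ-≡ (χ (s (suc i)) (s zero)) _ _
    (trans eq (cong (λ b → χ b (s zero) + rank (s ∘ suc) j) (sym ss)))))

-- Neighbourhood sums in the lexicographic product.

module _ {m n} (G : Graph m) (H : Graph n) where

  -- The two kinds of adjacency exclude each other because `G` is loopless, so the disjunction
  -- becomes a sum.
  adjacency-lexicographic : ∀ x g′ h′ → let (g , h) = remQuot n x in
    adjacency (G [ H ]) x (combine g′ h′) ≡ adjacency G g g′ + ⟦ does (g Fin.≟ g′) ⟧ * adjacency H h h′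
  adjacency-lexicographic x g′ h′ = trans
    (cong (λ (g″ , h″) → ⟦ does (adj? G g g″) ∨ does (g Fin.≟ g″) ∧ does (adj? H h h″) ⟧) (Fin.remQuot-combine g′ h′))
    disjoint
    where
    g : Fin m
    g = proj₁ (remQuot {m} n x)
    h : Fin n
    h = proj₂ (remQuot {m} n x)

    disjoint : ⟦ does (adj? G g g′) ∨ does (g Fin.≟ g′) ∧ does (adj? H h h′) ⟧ ≡
               adjacency G g g′ + ⟦ does (g Fin.≟ g′) ⟧ * adjacency H h h′
    disjoint with adj? G g g′ | g Fin.≟ g′
    ... | yes e | yes g≡g′ = contradiction e (loopless G g≡g′)
    ... | yes _ | no _  = refl
    ... | no _  | yes _ = sym (ℕ.*-identityˡ _)
    ... | no _  | no _  = refl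

  -- The neighbourhood consists of the whole fibres over the neighbours of `g` and a copy of the
  -- neighbourhood of `h` within the fibre of `g`.
  ∑-N-lexicographic : ∀ (f : Fin (m * n) → ℕ) x → let (g , h) = remQuot n x in
    ∑[ v < m * n ] (adjacency (G [ H ]) x v * f v) ≡
    ∑[ g′ < m ] (adjacency G g g′ * (∑[ h′ < n ] f (combine g′ h′))) +
    ∑[ h′ < n ] (adjacency H h h′ * f (combine g h′))
  ∑-N-lexicographic f x = begin
    ∑[ v < m * n ] (adjacency (G [ H ]) x v * f v)
      ≡⟨ ∑-combine m (λ v → adjacency (G [ H ]) x v * f v) ⟩
    ∑[ g′ < m ] ∑[ h′ < n ] (adjacency (G [ H ]) x (combine g′ h′) * f (combine g′ h′))
      ≡⟨ sum-cong-≗ fibre ⟩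
    ∑[ g′ < m ] (outer g′ + ⟦ does (g Fin.≟ g′) ⟧ * inner g′)
      ≡⟨ ∑-distrib-+ outer (λ g′ → ⟦ does (g Fin.≟ g′) ⟧ * inner g′) ⟩
    sum outer + ∑[ g′ < m ] (⟦ does (g Fin.≟ g′) ⟧ * inner g′)
      ≡⟨ cong (sum outer +_) (∑-select g inner) ⟩
    sum outer + inner g ∎
    where
    open ≡-Reasoning
    g : Fin m
    g = proj₁ (remQuot {m} n x)
    h : Fin n
    h = proj₂ (remQuot {m} n x)

    outer inner : Fin m → ℕ
    outer g′ = adjacency G g g′ * (∑[ h′ < n ] f (combine g′ h′))
    inner g′ = ∑[ h′ < n ] (adjacency H h h′ * f (combine g′ h′))

    distrib : ∀ a d b z → (a + d * b) * z ≡ a * z + d * (b * z)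
    distrib = solve-∀

    fibre : ∀ g′ → ∑[ h′ < n ] (adjacency (G [ H ]) x (combine g′ h′) * f (combine g′ h′)) ≡
                   outer g′ + ⟦ does (g Fin.≟ g′) ⟧ * inner g′
    fibre g′ = begin
      ∑[ h′ < n ] (adjacency (G [ H ]) x (combine g′ h′) * f (combine g′ h′))
        ≡⟨ sum-cong-≗ (λ h′ → trans (cong (_* f (combine g′ h′)) (adjacency-lexicographic x g′ h′))
             (distrib (adjacency G g g′) δ (adjacency H h h′) (f (combine g′ h′)))) ⟩
      ∑[ h′ < n ] (adjacency G g g′ * f (combine g′ h′) + δ * (adjacency H h h′ * f (combine g′ h′)))
        ≡⟨ ∑-distrib-+ (λ h′ → adjacency G g g′ * f (combine g′ h′)) (λ h′ → δ * (adjacency H h h′ * f (combine g′ h′))) ⟩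
      ∑[ h′ < n ] (adjacency G g g′ * f (combine g′ h′)) + ∑[ h′ < n ] (δ * (adjacency H h h′ * f (combine g′ h′)))
        ≡⟨ cong₂ _+_ (*-distribˡ-sum (adjacency G g g′) (λ h′ → f (combine g′ h′)))
                     (*-distribˡ-sum δ (λ h′ → adjacency H h h′ * f (combine g′ h′))) ⟨
      outer g′ + δ * inner g′ ∎
      where
      δ : ℕ
      δ = ⟦ does (g Fin.≟ g′) ⟧

cast-injective : ∀ {a b} (a≡b : a ≡ b) {i j : Fin a} → cast a≡b i ≡ cast a≡b j → i ≡ j
cast-injective a≡b {i} {j} eq = Fin.toℕ-injective
  (trans (sym (Fin.toℕ-cast a≡b i)) (trans (cong toℕ eq) (Fin.toℕ-cast a≡b j)))

-- The labeling of the product.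

module Construction {m n k t} (G : Graph m) (H : Graph n)
  (2≤k : 2 ≤ k) (G-regular : Regular k G)
  (side : Fin m → Bool) (proper : ∀ u v → Adj G u v → side u ≢ side v)
  (H-regular : Regular (2 * t) H)
  (colour : Fin n → Bool) (balanced : NeighborhoodBalanced H colour)
  (f : Labeling n) where

  p : ℕ
  p = count true side

  side-size : ∀ b → count b side ≡ p
  side-size true  = refl
  side-size false = sym (bipartite-halves G G-regular side proper)

  order : 2 * (n * p) ≡ m * n
  order = begin
    2 * (n * p)
      ≡⟨ rearrange n p ⟩
    (p + p) * n
      ≡⟨ cong (λ z → (p + z) * n) (side-size false) ⟨
    (count true side + count false side) * n
      ≡⟨ cong (_* n) (∑-distrib-+ (χ true ∘ side) (χ false ∘ side)) ⟨
    (∑[ g < m ] (χ true (side g) + χ false (side g))) * n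
      ≡⟨ cong (_* n) (trans (sum-cong-≗ (χ-partition ∘ side)) (trans (∑-const m 1) (ℕ.*-identityʳ m))) ⟩
    m * n ∎
    where
    open ≡-Reasoning
    rearrange : ∀ n p → 2 * (n * p) ≡ (p + p) * n
    rearrange = solve-∀

  position : Fin m → Fin p
  position g = fromℕ< (subst (rank side g <_) (side-size (side g)) (rank<count side g))

  position-injective : ∀ g g′ → side g ≡ side g′ → position g ≡ position g′ → g ≡ g′
  position-injective g g′ ss eq = rank-injective side g g′ ss
    (trans (sym (Fin.toℕ-fromℕ< _)) (trans (cong toℕ eq) (Fin.toℕ-fromℕ< _)))

  block : Bool → Fin 2
  block true  = zero
  block false = suc zero

  block-injective : ∀ b b′ → block b ≡ block b′ → b ≡ b′
  block-injective true  true  _ = refl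
  block-injective false false _ = refl

  -- One colour runs through the positions upwards, the other downwards; by `oriented-sum` two
  -- vertices of different colours in one fibre contribute `suc p` together.
  oriented : Bool → Fin p → Fin p
  oriented true  i = i
  oriented false i = opposite i

  oriented-injective : ∀ b {i j} → oriented b i ≡ oriented b j → i ≡ j
  oriented-injective true  eq = eq
  oriented-injective false {i} {j} eq =
    trans (sym (Fin.opposite-involutive i)) (trans (cong opposite eq) (Fin.opposite-involutive j))

  oriented-sum : ∀ i → suc (toℕ (oriented true i)) + suc (toℕ (oriented false i)) ≡ suc p
  oriented-sum i = trans (ℕ.+-suc (suc (toℕ i)) (toℕ (opposite i)))
    (cong suc (trans (cong (suc (toℕ i) +_) (Fin.opposite-prop i)) (ℕ.m+[n∸m]≡n (Fin.toℕ<n i))))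

  -- A mixed-radix numeral with digits in bases 2, `n` and `p`: the side of `g`, the label of `h`,
  -- the oriented position of `g`.
  element : Fin m × Fin n → Fin (m * n)
  element (g , h) = cast order
    (combine (block (side g)) (combine (Bijection.to f h) (oriented (colour h) (position g))))

  element-injective : ∀ x y → element x ≡ element y → x ≡ y
  element-injective (g , h) (g′ , h′) eq
    with blocks , rest ← Fin.combine-injective (block (side g)) _ (block (side g′)) _ (cast-injective order eq)
    with labels , positions ← Fin.combine-injective (Bijection.to f h) _ (Bijection.to f h′) _ rest
    -- `h` is recovered before `g`: only with equal colours do both last digits use the same
    -- orientation.
    with refl ← Bijection.injective f labels
    = cong (_, h) (position-injective g g′ (block-injective _ _ blocks) (oriented-injective (colour h) positions))

  F : Labeling (m * n)
  F = injective⇒labeling (element ∘ remQuot n) λ {x} {y} eq →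
    trans (sym (Fin.combine-remQuot {m} n x))
      (trans (cong (uncurry combine) (element-injective (remQuot n x) (remQuot n y) eq)) (Fin.combine-remQuot {m} n y))

  offset : Bool → ℕ
  offset b = n * p * toℕ (block b)

  label-F : ∀ g h → label F (combine g h) ≡
    offset (side g) + p * toℕ (Bijection.to f h) + suc (toℕ (oriented (colour h) (position g)))
  label-F g h = begin
    suc (toℕ (element (remQuot n (combine g h))))
      ≡⟨ cong (suc ∘ toℕ ∘ element) (Fin.remQuot-combine g h) ⟩
    suc (toℕ (element (g , h)))
      ≡⟨ cong suc (trans (Fin.toℕ-cast order _) (Fin.toℕ-combine (block (side g)) _)) ⟩
    suc (offset (side g) + toℕ (combine (Bijection.to f h) i))
      ≡⟨ cong (λ z → suc (offset (side g) + z)) (Fin.toℕ-combine (Bijection.to f h) i) ⟩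
    suc (offset (side g) + (p * toℕ (Bijection.to f h) + toℕ i))
      ≡⟨ cong suc (ℕ.+-assoc (offset (side g)) _ _) ⟨
    suc (offset (side g) + p * toℕ (Bijection.to f h) + toℕ i)
      ≡⟨ ℕ.+-suc _ (toℕ i) ⟨
    offset (side g) + p * toℕ (Bijection.to f h) + suc (toℕ i) ∎
    where
    open ≡-Reasoning
    i : Fin p
    i = oriented (colour h) (position g)

  -- Each colour has total weight q, so the position of g cancels.
  fibre-sum : ∀ (wt : Fin n → ℕ) q → (∀ b → ∑[ h < n ] (wt h * χ b (colour h)) ≡ q) → ∀ g →
    ∑[ h < n ] (wt h * label F (combine g h)) ≡
    sum wt * offset (side g) + (p * (∑[ h < n ] (wt h * toℕ (Bijection.to f h))) + q * suc p)
  fibre-sum wt q halves g = begin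
    ∑[ h < n ] (wt h * label F (combine g h))
      ≡⟨ sum-cong-≗ (λ h → trans (cong (wt h *_) (label-F g h))
           (distrib (wt h) (offset (side g)) p (toℕ (Bijection.to f h)) (r (colour h)))) ⟩
    ∑[ h < n ] (wt h * offset (side g) + p * (wt h * toℕ (Bijection.to f h)) + wt h * r (colour h))
      ≡⟨ ∑-distrib-+³ (λ h → wt h * offset (side g)) (λ h → p * (wt h * toℕ (Bijection.to f h))) (λ h → wt h * r (colour h)) ⟩
    ∑[ h < n ] (wt h * offset (side g)) + ∑[ h < n ] (p * (wt h * toℕ (Bijection.to f h))) + ∑[ h < n ] (wt h * r (colour h))
      ≡⟨ cong₂ _+_
           (cong₂ _+_ (sym (*-distribʳ-sum (offset (side g)) wt))
                      (sym (*-distribˡ-sum p (λ h → wt h * toℕ (Bijection.to f h)))))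
           colours ⟩
    sum wt * offset (side g) + p * (∑[ h < n ] (wt h * toℕ (Bijection.to f h))) + q * suc p
      ≡⟨ ℕ.+-assoc (sum wt * offset (side g)) _ _ ⟩
    sum wt * offset (side g) + (p * (∑[ h < n ] (wt h * toℕ (Bijection.to f h))) + q * suc p) ∎
    where
    open ≡-Reasoning
    r : Bool → ℕ
    r b = suc (toℕ (oriented b (position g)))

    distrib : ∀ w o p l r → w * (o + p * l + r) ≡ w * o + p * (w * l) + w * r
    distrib = solve-∀

    colours : ∑[ h < n ] (wt h * r (colour h)) ≡ q * suc p
    colours = begin
      ∑[ h < n ] (wt h * r (colour h))
        ≡⟨ ∑-colours wt colour r ⟩
      (∑[ h < n ] (wt h * χ true (colour h))) * r true + (∑[ h < n ] (wt h * χ false (colour h))) * r false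
        ≡⟨ cong₂ (λ a b → a * r true + b * r false) (halves true) (halves false) ⟩
      q * r true + q * r false
        ≡⟨ ℕ.*-distribˡ-+ q (r true) (r false) ⟨
      q * (r true + r false)
        ≡⟨ cong (q *_) (oriented-sum (position g)) ⟩
      q * suc p ∎

  -- Weights of the product labeling.

  -- The weight of `h` under `f` with every label lowered by one, which is how `f` enters `label-F`.
  neighbourSum : Fin n → ℕ
  neighbourSum h = ∑[ h′ < n ] (adjacency H h h′ * toℕ (Bijection.to f h′))

  weight-f : ∀ h → weight H f h ≡ 2 * t + neighbourSum h
  weight-f h = begin
    weight H f h
      ≡⟨ sum-N H (label f) h ⟩
    ∑[ h′ < n ] (adjacency H h h′ * label f h′)
      ≡⟨ sum-cong-≗ (λ h′ → ℕ.*-suc (adjacency H h h′) _) ⟩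
    ∑[ h′ < n ] (adjacency H h h′ + adjacency H h h′ * toℕ (Bijection.to f h′))
      ≡⟨ ∑-distrib-+ (adjacency H h) (λ h′ → adjacency H h h′ * toℕ (Bijection.to f h′)) ⟩
    sum (adjacency H h) + neighbourSum h
      ≡⟨ cong (_+ neighbourSum h) (degree H H-regular h) ⟩
    2 * t + neighbourSum h ∎
    where open ≡-Reasoning

  weight-f≤ : ∀ h → weight H f h ≤ 2 * t * n
  weight-f≤ h = begin
    weight H f h
      ≡⟨ sum-N H (label f) h ⟩
    ∑[ h′ < n ] (adjacency H h h′ * label f h′)
      ≤⟨ ∑-mono-≤ (λ h′ → ℕ.*-monoʳ-≤ (adjacency H h h′) (Fin.toℕ<n (Bijection.to f h′))) ⟩
    ∑[ h′ < n ] (adjacency H h h′ * n)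
      ≡⟨ *-distribʳ-sum n (adjacency H h) ⟨
    sum (adjacency H h) * n
      ≡⟨ cong (_* n) (degree H H-regular h) ⟩
    2 * t * n ∎
    where open ℕ.≤-Reasoning

  -- The part of a fibre's label sum that does not depend on `g`. The factor `1` is the constant
  -- weight with which `fibre-sum` is applied.
  T : ℕ
  T = p * (∑[ h < n ] (1 * toℕ (Bijection.to f h))) + count true colour * suc p

  fibre-total : ∀ g → ∑[ h < n ] label F (combine g h) ≡ n * offset (side g) + T
  fibre-total g = begin
    ∑[ h < n ] label F (combine g h)
      ≡⟨ sum-cong-≗ (λ h → ℕ.*-identityˡ (label F (combine g h))) ⟨
    ∑[ h < n ] (1 * label F (combine g h))
      ≡⟨ fibre-sum (λ _ → 1) (count true colour) halves g ⟩
    (∑[ h < n ] 1) * offset (side g) + T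
      ≡⟨ cong (λ z → z * offset (side g) + T) (trans (∑-const n 1) (ℕ.*-identityʳ n)) ⟩
    n * offset (side g) + T ∎
    where
    open ≡-Reasoning
    halves : ∀ b → ∑[ h < n ] (1 * χ b (colour h)) ≡ count true colour
    halves true  = sum-cong-≗ (λ h → ℕ.*-identityˡ (χ true (colour h)))
    halves false = trans (sum-cong-≗ (λ h → ℕ.*-identityˡ (χ false (colour h))))
      (sym (balanced-halves H H-regular colour balanced))

  -- The first summand collects the `k` whole fibres over the opposite side, the second the `2 * t`
  -- neighbours in the vertex's own fibre.
  ψ : Bool → ℕ → ℕ
  ψ b w = k * (n * offset (not b) + T) + (2 * t * offset b + (p * w + t * suc p))

  weight-F : ∀ x → let (g , h) = remQuot n x in weight (G [ H ]) F x ≡ ψ (side g) (neighbourSum h)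
  weight-F x = begin
    weight (G [ H ]) F x
      ≡⟨ sum-N (G [ H ]) (label F) x ⟩
    ∑[ v < m * n ] (adjacency (G [ H ]) x v * label F v)
      ≡⟨ ∑-N-lexicographic G H (label F) x ⟩
    ∑[ g′ < m ] (adjacency G g g′ * (∑[ h′ < n ] label F (combine g′ h′))) +
    ∑[ h′ < n ] (adjacency H h h′ * label F (combine g h′))
      ≡⟨ cong₂ _+_ outer inner ⟩
    ψ (side g) (neighbourSum h) ∎
    where
    open ≡-Reasoning
    g : Fin m
    g = proj₁ (remQuot {m} n x)
    h : Fin n
    h = proj₂ (remQuot {m} n x)

    inner : ∑[ h′ < n ] (adjacency H h h′ * label F (combine g h′)) ≡
            2 * t * offset (side g) + (p * neighbourSum h + t * suc p)
    inner = trans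
      (fibre-sum (adjacency H h) t (λ b → balanced-half-degree H H-regular colour balanced b h) g)
      (cong (λ d → d * offset (side g) + (p * neighbourSum h + t * suc p)) (degree H H-regular h))

    total : ℕ
    total = n * offset (not (side g)) + T

    outer : ∑[ g′ < m ] (adjacency G g g′ * (∑[ h′ < n ] label F (combine g′ h′))) ≡ k * total
    outer = begin
      ∑[ g′ < m ] (adjacency G g g′ * (∑[ h′ < n ] label F (combine g′ h′)))
        -- All neighbours of `g` lie on the other side, so their fibres have the same total.
        ≡⟨ sum-cong-≗ (λ g′ → adjacency-cong G {g} {g′} λ e → trans (fibre-total g′)
             (cong (λ b → n * offset b + T) (Bool.¬-not (proper g g′ e ∘ sym)))) ⟩
      ∑[ g′ < m ] (adjacency G g g′ * total)
        ≡⟨ *-distribʳ-sum total (adjacency G g) ⟨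
      sum (adjacency G g) * total
        ≡⟨ cong (_* total) (degree G G-regular g) ⟩
      k * total ∎

  -- Separation and number of the weights.

  -- `ψ b` is affine with slope `p`; the argument in `Fin p` witnesses that `p` is nonzero.
  ψ-injective : Fin p → ∀ b {w w′} → ψ b w ≡ ψ b w′ → w ≡ w′
  ψ-injective i b {w} {w′} eq = ℕ.*-cancelˡ-≡ w w′ p {{Fin.nonZeroIndex i}}
    (ℕ.+-cancelʳ-≡ (t * suc p) _ _ (ℕ.+-cancelˡ-≡ (2 * t * offset b) _ _
      (ℕ.+-cancelˡ-≡ (k * (n * offset (not b) + T)) _ _ eq)))

  -- Both summands are at most `2 * t * n`, hence at most `n * n` since a degree is bounded by the
  -- order. Here `2 ≤ k` enters.
  gap : ∀ h → 2 * t * n + neighbourSum h < k * (n * n)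
  gap h = begin-strict
    2 * t * n + neighbourSum h
      <⟨ ℕ.+-monoʳ-< (2 * t * n) (begin-strict
           -- Strict because `2 * t` is positive, no vertex being isolated.
           neighbourSum h         <⟨ ℕ.m<n+m (neighbourSum h) (degree>0 H H-regular h) ⟩
           2 * t + neighbourSum h ≡⟨ weight-f h ⟨
           weight H f h           ≤⟨ weight-f≤ h ⟩
           2 * t * n              ∎) ⟩
    2 * t * n + 2 * t * n
      ≤⟨ ℕ.+-mono-≤ 2tn≤n² 2tn≤n² ⟩
    n * n + n * n
      ≡⟨ cong (n * n +_) (ℕ.+-identityʳ (n * n)) ⟨
    2 * (n * n)
      ≤⟨ ℕ.*-monoˡ-≤ (n * n) 2≤k ⟩
    k * (n * n) ∎
    where
    open ℕ.≤-Reasoning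
    2tn≤n² : 2 * t * n ≤ n * n
    2tn≤n² = ℕ.*-monoˡ-≤ n (degree≤order H H-regular h)

  -- The offset `n * p` enters `ψ true` with factor `k * n`, through the fibres over the `false`
  -- side, but enters `ψ false` only with factor `2 * t`. Removing common terms and the factor `p`
  -- leaves `gap`.
  ψ-sides-disjoint : Fin p → ∀ w h → ψ false (neighbourSum h) < ψ true w
  ψ-sides-disjoint i w h = begin-strict
    ψ false (neighbourSum h)
      ≡⟨ expand-false k n p T t (neighbourSum h) ⟩
    k * T + t * suc p + p * (2 * t * n + neighbourSum h)
      <⟨ ℕ.+-monoʳ-< (k * T + t * suc p) (ℕ.*-monoʳ-< p {{Fin.nonZeroIndex i}}
           (ℕ.<-≤-trans (gap h) (ℕ.m≤m+n (k * (n * n)) w))) ⟩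
    k * T + t * suc p + p * (k * (n * n) + w)
      ≡⟨ expand-true k n p T t w ⟨
    ψ true w ∎
    where
    open ℕ.≤-Reasoning
    expand-false : ∀ k n p T t w →
      k * (n * (n * p * 0) + T) + (2 * t * (n * p * 1) + (p * w + t * (1 + p))) ≡
      k * T + t * (1 + p) + p * (2 * t * n + w)
    expand-false = solve-∀
    expand-true : ∀ k n p T t w →
      k * (n * (n * p * 1) + T) + (2 * t * (n * p * 0) + (p * w + t * (1 + p))) ≡
      k * T + t * (1 + p) + p * (k * (n * n) + w)
    expand-true = solve-∀

  -- Edges from `G` join the two sides, whose weights are disjoint. Within a fibre, `ψ-injective`
  -- reduces equal weights to equal weights of `f` along an edge of `H`.
  F-antimagic : IsLocalDistanceAntimagic H f → IsLocalDistanceAntimagic (G [ H ]) F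
  F-antimagic lda x y adj eq = separate adj (trans (sym (weight-F x)) (trans eq (weight-F y)))
    where
    sides : Fin p → ∀ b b′ h h′ → b ≢ b′ → ψ b (neighbourSum h) ≢ ψ b′ (neighbourSum h′)
    sides i true  true  h h′ b≢b′ _  = b≢b′ refl
    sides i true  false h h′ _    eq = ℕ.<⇒≢ (ψ-sides-disjoint i (neighbourSum h) h′) (sym eq)
    sides i false true  h h′ _    eq = ℕ.<⇒≢ (ψ-sides-disjoint i (neighbourSum h′) h) eq
    sides i false false h h′ b≢b′ _  = b≢b′ refl

    separate : Adj (G [ H ]) x y → let (g , h) = remQuot n x ; (g′ , h′) = remQuot n y in
      ψ (side g) (neighbourSum h) ≢ ψ (side g′) (neighbourSum h′)
    separate (inj₁ e) = sides (position (proj₁ (remQuot {m} n x))) _ _ _ _ (proper _ _ e)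
    separate (inj₂ (g≡g′ , e)) eq = lda _ _ e (trans (weight-f _) (trans (cong (2 * t +_)
      (ψ-injective (position (proj₁ (remQuot {m} n x))) (side (proj₁ (remQuot {m} n y)))
        (trans (cong (λ g → ψ (side g) _) (sym g≡g′)) eq)))
      (sym (weight-f _))))

  -- Every weight of `F` is the image of a weight of `f` under one of two maps, one per side.
  #weights-F : #weights (G [ H ]) F ≤ 2 * #weights H f
  #weights-F = begin
    #weights (G [ H ]) F
      ≤⟨ unique-⊆⇒length≤ (deduplicate-! ℕ._≟_ (map (weight (G [ H ]) F) (allFin (m * n)))) covered ⟩
    length (map (φ true) ws ++ map (φ false) ws)
      ≡⟨ List.length-++ (map (φ true) ws) ⟩
    length (map (φ true) ws) + length (map (φ false) ws)
      ≡⟨ cong₂ _+_ (List.length-map (φ true) ws) (List.length-map (φ false) ws) ⟩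
    length ws + length ws
      ≡⟨ cong (length ws +_) (ℕ.+-identityʳ (length ws)) ⟨
    2 * #weights H f ∎
    where
    open ℕ.≤-Reasoning
    ws : List ℕ
    ws = deduplicate ℕ._≟_ (map (weight H f) (allFin n))

    φ : Bool → ℕ → ℕ
    -- The truncated subtraction is exact on weights of `f`: each is `2 * t` plus a `neighbourSum`.
    φ b w = ψ b (w ∸ 2 * t)

    φ-weight : ∀ b h → φ b (weight H f h) ≡ ψ b (neighbourSum h)
    φ-weight b h = cong (ψ b) (trans (cong (_∸ 2 * t) (weight-f h)) (ℕ.m+n∸m≡n (2 * t) (neighbourSum h)))

    φ∈ : ∀ b h → φ b (weight H f h) ∈ map (φ true) ws ++ map (φ false) ws
    φ∈ b h = place b (∈-deduplicate⁺ ℕ._≟_ (∈-map⁺ (weight H f) (∈-allFin h)))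
      where
      place : ∀ b {w} → w ∈ ws → φ b w ∈ map (φ true) ws ++ map (φ false) ws
      place true  w∈ = ∈-++⁺ˡ (∈-map⁺ (φ true) w∈)
      place false w∈ = ∈-++⁺ʳ (map (φ true) ws) (∈-map⁺ (φ false) w∈)

    covered : deduplicate ℕ._≟_ (map (weight (G [ H ]) F) (allFin (m * n))) ⊆ map (φ true) ws ++ map (φ false) ws
    covered w∈ with x , _ , refl ← ∈-map⁻ (weight (G [ H ]) F) (∈-deduplicate⁻ ℕ._≟_ _ w∈) =
      subst (_∈ map (φ true) ws ++ map (φ false) ws) (trans (φ-weight _ _) (sym (weight-F x))) (φ∈ _ _)

theorem6p1 : ∀ {m n k t : ℕ} (G : Graph m) (H : Graph n) →
    2 ≤ k → Regular k G → Bipartite G →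
    Regular (2 * t) H → AdmitsNeighborhoodBalancedColoring H → AdmitsLocalDistanceAntimagic H →
    ∃[ c ] ∃[ d ] ((χld H ≔ c) × (χld (G [ H ]) ≔ d) × (d ≤ 2 * c))
theorem6p1 {t = t} G H 2≤k G-regular (side , proper) H-regular (colour , balanced) H-lda
  -- Taking `f` optimal and matching `refl` turns `c` into `#weights H f`, the quantity bounded in
  -- `#weights-F`.
  with c , χH@((f , f-lda , refl) , _) ← χld-exists H H-lda =
  let open Construction {t = t} G H 2≤k G-regular side proper H-regular colour balanced f
      d , χGH = χld-exists (G [ H ]) (F , F-antimagic f-lda)
  in c , d , χH , χGH , ℕ.≤-trans (proj₂ χGH F (F-antimagic f-lda)) #weights-F
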